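{- Let $\Gamma=(V,E)$ be a finite, undirected, unweighted, connected graph with $N\ge2$ vertices (loops allowed), with Cheeger constant $h$, dual Cheeger constant $\overline{h}$, and balance constant $\mathcal{R}$. Then $$\frac{N-1}{N}\,h\le\frac{2\mathcal{R}}{1+\mathcal{R}}\,h\le\overline{h}\le1,$$ and equality holds in the first (leftmost) inequality if and only if $\Gamma$ is a regular graph and $N$ is odd.
   Context: Unweighted means $w_{ij}=1$ if $i\sim j$ (i.e. $i,j$ are joined by an edge; $i=j$ allowed, a loop) and $w_{ij}=0$ otherwise. The degree is $d_i=\sum_jw_{ij}$; regular means all $d_i$ are equal. $\mathrm{vol}(U)=\sum_{i\in U}d_i$, $|E(U,W)|=\sum_{k\in U,l\in W}w_{kl}$, $\overline{U}=V\setminus U$. The Cheeger constant is $h=\min_U\frac{|E(U,\overline{U})|}{\min\{\mathrm{vol}(U),\mathrm{vol}(\overline{U})\}}$ over $U$ with $U,\overline{U}$ nonempty. The dual Cheeger constant is $\overline{h}=\max_{V_1,V_2}\frac{2|E(V_1,V_2)|}{\mathrm{vol}(V_1)+\mathrm{vol}(V_2)}$ over disjoint nonempty $V_1,V_2\subseteq V$ (whose union need not be $V$). Finally $\mathcal{R}=\max_U\mathcal{R}(U)$ over partitions $U,\overline{U}$ of $V$, where $\mathcal{R}(U)=\frac{\min(\mathrm{vol}(U),\mathrm{vol}(\overline{U}))}{\max(\mathrm{vol}(U),\mathrm{vol}(\overline{U}))}$. -}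

module Defs where

open import Data.Bool.Base using (if_then_else_)
open import Data.Fin.Base using (Fin)
open import Data.Fin.Subset using (Subset; Side; inside; outside; _∩_; ∁; Nonempty; Empty)
open import Data.Fin.Subset.Properties using (_∈?_; nonempty?)
open import Data.Integer.Base using (+_)
open import Data.List.Base using (List; []; _∷_; map; filter; cartesianProduct; cartesianProductWith)
open import Data.List.Membership.Propositional using (_∈_)
open import Data.List.Membership.Propositional.Properties using (∈-cartesianProductWith⁺)
open import Data.List.Relation.Unary.Any using (here; there)
open import Data.Nat.Base using (ℕ; zero; suc; _+_; _*_; _⊓_; _⊔_)
open import Data.Nat.Properties using (+-0-commutativeMonoid)
open import Data.Product.Base using (_×_; _,_; uncurry)
open import Data.Rational.Base using (ℚ; 0ℚ; _/_; _÷_; ≢-nonZero)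
open import Data.Rational.Properties using (_≟_; ≤-decTotalOrder)
import Data.Vec.Base as Vec
open import Level using (0ℓ)
open import Relation.Binary.Bundles using (DecTotalOrder)
open import Relation.Binary.Construct.Closure.ReflexiveTransitive using (Star)
open import Relation.Binary.Core using (Rel)
open import Relation.Binary.Definitions using (Decidable; Symmetric)
open import Relation.Binary.PropositionalEquality.Core using (_≡_; refl)
open import Relation.Nullary.Decidable using (Dec; yes; no; does; _×-dec_; ¬?)

open import Algebra.Properties.CommutativeMonoid.Sum +-0-commutativeMonoid using (sum-syntax)
open import Data.List.Extrema (DecTotalOrder.totalOrder ≤-decTotalOrder) using (min; max)

-- Irreflexivity is not required: i ∼ i is a loop at i.
record Graph (N : ℕ) : Set₁ where
  field
    _∼_  : Rel (Fin N) 0ℓ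
    sym  : Symmetric _∼_
    _∼?_ : Decidable _∼_

fromℕ : ℕ → ℚ
fromℕ n = + n / 1

-- Division on ℚ made total by p ⊘ 0 = 0.  In a connected graph with at least
-- two vertices every degree is positive, so none of the denominators below
-- vanishes and this convention is never used.
infixl 7 _⊘_
_⊘_ : ℚ → ℚ → ℚ
p ⊘ q with q ≟ 0ℚ
... | yes _  = 0ℚ
... | no q≢0 = _÷_ p q {{≢-nonZero q≢0}}

-- The value 0 on the empty list is never used when there are at least two
-- vertices: the lists below are then nonempty.
minimum : List ℚ → ℚ
minimum []       = 0ℚ
minimum (x ∷ xs) = min x xs

maximum : List ℚ → ℚ
maximum []       = 0ℚ
maximum (x ∷ xs) = max x xs

subsets : ∀ n → List (Subset n)
subsets zero    = Vec.[] ∷ []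
subsets (suc n) = cartesianProductWith Vec._∷_ (inside ∷ outside ∷ []) (subsets n)

∈-subsets : ∀ {n} (U : Subset n) → U ∈ subsets n
∈-subsets Vec.[]      = here refl
∈-subsets (s Vec.∷ U) = ∈-cartesianProductWith⁺ Vec._∷_ (∈-sides s) (∈-subsets U)
  where
  ∈-sides : (s : Side) → s ∈ (inside ∷ outside ∷ [])
  ∈-sides inside  = here refl
  ∈-sides outside = there (here refl)

Proper : ∀ {n} → Subset n → Set
Proper U = Nonempty U × Nonempty (∁ U)

proper? : ∀ {n} (U : Subset n) → Dec (Proper U)
proper? U = nonempty? U ×-dec nonempty? (∁ U)

DisjointNonempty : ∀ {n} → Subset n × Subset n → Set
DisjointNonempty (V₁ , V₂) = Nonempty V₁ × Nonempty V₂ × Empty (V₁ ∩ V₂)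

disjointNonempty? : ∀ {n} (P : Subset n × Subset n) → Dec (DisjointNonempty P)
disjointNonempty? (V₁ , V₂) =
  nonempty? V₁ ×-dec nonempty? V₂ ×-dec ¬? (nonempty? (V₁ ∩ V₂))

sumOver : ∀ {n} → Subset n → (Fin n → ℕ) → ℕ
sumOver {n} U f = ∑[ i < n ] (if does (i ∈? U) then f i else 0)

module _ {N : ℕ} (G : Graph N) where
  open Graph G

  Connected : Set
  Connected = ∀ i j → Star _∼_ i j

  weight : Fin N → Fin N → ℕ
  weight i j = if does (i ∼? j) then 1 else 0

  degree : Fin N → ℕ
  degree i = ∑[ j < N ] weight i j

  Regular : Set
  Regular = ∀ i j → degree i ≡ degree j

  vol : Subset N → ℕ
  vol U = sumOver U degree

  -- |E(U,W)|
  edges : Subset N → Subset N → ℕ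
  edges U W = sumOver U λ k → sumOver W λ l → weight k l

  cheegerRatio : Subset N → ℚ
  cheegerRatio U = fromℕ (edges U (∁ U)) ⊘ fromℕ (vol U ⊓ vol (∁ U))

  dualCheegerRatio : Subset N → Subset N → ℚ
  dualCheegerRatio V₁ V₂ = fromℕ (2 * edges V₁ V₂) ⊘ fromℕ (vol V₁ + vol V₂)

  balanceRatio : Subset N → ℚ
  balanceRatio U = fromℕ (vol U ⊓ vol (∁ U)) ⊘ fromℕ (vol U ⊔ vol (∁ U))

  cheeger : ℚ
  cheeger = minimum (map cheegerRatio (filter proper? (subsets N)))

  dualCheeger : ℚ
  dualCheeger = maximum (map (uncurry dualCheegerRatio)
    (filter disjointNonempty? (cartesianProduct (subsets N) (subsets N))))

  balance : ℚ
  balance = maximum (map balanceRatio (filter proper? (subsets N)))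

{-# OPTIONS --safe #-}

-- If a partition U, Ū of least discrepancy has lighter volume μ, then 2R/(1+R) = 2μ/vol(V), and
-- the cut (U, Ū) itself gives 2R/(1+R) · h ≤ 2|E(U,Ū)|/vol(V) ≤ h̄.  The first inequality thus
-- asks for a partition with N·s ≤ vol(V), where s = |vol(U) − vol(Ū)|.  Put the vertices, in order
-- of decreasing degree, each on the lighter side.  The final s is either at most the minimal degree,
-- or at most x − T, where at least j degrees are ≥ x and the other k = N − j degrees sum to T;
-- since T ≥ k and x ≤ N, the latter gives N·s ≤ j·x + k·x − N·T ≤ j·x < vol(V).  Equality
-- therefore forces all degrees to equal s, and then |U| = |Ū| + 1.
module Submission where

open import Defs
open import Algebra.Lattice.Properties.BooleanAlgebra using (¬-involutive)
open import Data.Bool.Base using (if_then_else_)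
open import Data.Fin.Base using (Fin; zero; suc; punchIn)
open import Data.Fin.Properties using (punchInᵢ≢i)
open import Data.Fin.Subset using (Subset; inside; outside; ∁; ∣_∣; Nonempty; _∈_)
open import Data.Fin.Subset.Properties
  using (_∈?_; ∪-∩-booleanAlgebra; ∣p∣≤n; ∣∁p∣≡n∸∣p∣; x∉p⇒x∈∁p; x∈∁p⇒x∉p; x∈p∩q⁻)
import Data.Integer.Base as ℤ
import Data.Integer.Properties as ℤ
open import Data.List.Base using (List; _∷_; map; filter; cartesianProduct; allFin)
import Data.List.Extrema as Extrema
import Data.List.Extrema.Nat as ExtremaNat
import Data.List.Membership.Propositional as List
open import Data.List.Membership.Propositional.Properties
  using (∈-allFin; ∈-map⁺; ∈-map⁻; ∈-filter⁺; ∈-filter⁻; ∈-cartesianProduct⁺)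
import Data.List.Relation.Unary.All as All
open import Data.List.Relation.Unary.Any using (here; there)
open import Data.Nat.Base using (ℕ; _∸_; _%_) renaming (_≤_ to _≤ℕ_)
import Data.Nat.Base as ℕ
import Data.Nat.Coprimality as Coprimality
import Data.Nat.Properties as ℕ
open import Data.Product.Base using (_×_; _,_; uncurry; ∃; proj₁; proj₂)
open import Data.Sum.Base using (_⊎_; inj₁; inj₂; [_,_]′)
open import Data.Vec.Base as Vec using ([]; _∷_; insertAt)
open import Data.Vec.Functional using (removeAt)
open import Data.Vec.Properties using (map-insertAt)
open import Function.Base using (_∘_)
open import Function.Bundles using (_⇔_; mk⇔)
open import Relation.Binary.Bundles using (DecTotalOrder)
open import Relation.Binary.Construct.Closure.ReflexiveTransitive using (Star; ε; _◅_)
open import Relation.Binary.PropositionalEquality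
  using (_≡_; _≢_; refl; sym; trans; cong; cong₂; subst; subst₂; module ≡-Reasoning)
open import Relation.Nullary.Decidable using (Dec; yes; no; dec-true)
open import Relation.Nullary.Negation using (contradiction)

-- Finite sums over index sets and their subsets.

module Sums where
  open import Data.Nat.Base
  open import Data.Nat.Properties
  open import Algebra.Properties.CommutativeSemigroup +-commutativeSemigroup using (x∙yz≈y∙xz)
  open import Algebra.Properties.CommutativeMonoid.Sum +-0-commutativeMonoid
    using (sum; sum-remove; ∑-distrib-+; sum-replicate-zero)

  sum-mono : ∀ {n} {f g : Fin n → ℕ} → (∀ i → f i ≤ g i) → sum f ≤ sum g
  sum-mono {zero}  f≤g = z≤n
  sum-mono {suc n} f≤g = +-mono-≤ (f≤g zero) (sum-mono (f≤g ∘ suc))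

  sum-const : ∀ n s → sum {n} (λ _ → s) ≡ n * s
  sum-const zero    s = refl
  sum-const (suc n) s = cong (s +_) (sum-const n s)

  *≤sum : ∀ {n s} {f : Fin n → ℕ} → (∀ i → s ≤ f i) → n * s ≤ sum f
  *≤sum {n} {s} s≤f = ≤-trans (≤-reflexive (sym (sum-const n s))) (sum-mono s≤f)

  sum≤* : ∀ {n s} {f : Fin n → ℕ} → (∀ i → f i ≤ s) → sum f ≤ n * s
  sum≤* {n} {s} f≤s = ≤-trans (sum-mono f≤s) (≤-reflexive (sum-const n s))

  term≤sum : ∀ {n} (f : Fin n → ℕ) i → f i ≤ sum f
  term≤sum f zero    = m≤m+n (f zero) _
  term≤sum f (suc i) = ≤-trans (term≤sum (f ∘ suc) i) (m≤n+m _ (f zero))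

  -- The terms other than `f i` already contribute at least s each, so the bound on the sum leaves
  -- at most s for `f i`.
  sum-tight : ∀ {n s} (f : Fin n → ℕ) → (∀ i → s ≤ f i) → sum f ≤ n * s → ∀ i → f i ≡ s
  sum-tight {suc n} {s} f s≤f ∑f≤ i = ≤-antisym (+-cancelʳ-≤ (n * s) (f i) s (begin
    f i + n * s              ≤⟨ +-monoʳ-≤ (f i) (*≤sum (s≤f ∘ punchIn i)) ⟩
    f i + sum (removeAt f i) ≡⟨ sum-remove f ⟨
    sum f                    ≤⟨ ∑f≤ ⟩
    s + n * s                ∎)) (s≤f i)
    where open ≤-Reasoning

  sumOver-mono : ∀ {n} (U : Subset n) {f g : Fin n → ℕ} → (∀ i → f i ≤ g i) →
                 sumOver U f ≤ sumOver U g
  sumOver-mono []            f≤g = z≤n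
  sumOver-mono (inside  ∷ U) f≤g = +-mono-≤ (f≤g zero) (sumOver-mono U (f≤g ∘ suc))
  sumOver-mono (outside ∷ U) f≤g = sumOver-mono U (f≤g ∘ suc)

  sumOver-∁ : ∀ {n} (U : Subset n) f → sumOver U f + sumOver (∁ U) f ≡ sum f
  sumOver-∁ []            f = refl
  sumOver-∁ (inside  ∷ U) f = trans (+-assoc (f zero) _ _) (cong (f zero +_) (sumOver-∁ U (f ∘ suc)))
  sumOver-∁ (outside ∷ U) f = trans (x∙yz≈y∙xz (sumOver U (f ∘ suc)) (f zero) (sumOver (∁ U) (f ∘ suc)))
    (cong (f zero +_) (sumOver-∁ U (f ∘ suc)))

  sumOver≤sum : ∀ {n} (U : Subset n) f → sumOver U f ≤ sum f
  sumOver≤sum U f = m+n≤o⇒m≤o _ (≤-reflexive (sumOver-∁ U f))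

  sumOver-const : ∀ {n} (U : Subset n) s → sumOver U (λ _ → s) ≡ ∣ U ∣ * s
  sumOver-const []            s = refl
  sumOver-const (inside  ∷ U) s = cong (s +_) (sumOver-const U s)
  sumOver-const (outside ∷ U) s = sumOver-const U s

  sumOver-constant : ∀ {n} (U : Subset n) {f : Fin n → ℕ} {s} → (∀ i → f i ≡ s) →
                     sumOver U f ≡ ∣ U ∣ * s
  sumOver-constant U {f} {s} f≡s = trans
    (≤-antisym (sumOver-mono U (≤-reflexive ∘ f≡s)) (sumOver-mono U (≤-reflexive ∘ sym ∘ f≡s)))
    (sumOver-const U s)

  term≤sumOver : ∀ {n} {U : Subset n} f {i} → i ∈ U → f i ≤ sumOver U f
  term≤sumOver {U = inside  ∷ U} f Vec.here        = m≤m+n (f zero) _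
  term≤sumOver {U = inside  ∷ U} f (Vec.there i∈U) = ≤-trans (term≤sumOver (f ∘ suc) i∈U) (m≤n+m _ (f zero))
  term≤sumOver {U = outside ∷ U} f (Vec.there i∈U) = term≤sumOver (f ∘ suc) i∈U

  sumOver>0⇒nonempty : ∀ {n} (U : Subset n) f → 0 < sumOver U f → Nonempty U
  sumOver>0⇒nonempty (inside  ∷ U) f 0<∑ = zero , Vec.here
  sumOver>0⇒nonempty (outside ∷ U) f 0<∑ with i , i∈U ← sumOver>0⇒nonempty U (f ∘ suc) 0<∑ =
    suc i , Vec.there i∈U

  sumOver-insertAt : ∀ {n} (U : Subset n) (f : Fin (suc n) → ℕ) i b →
    sumOver (insertAt U i b) f ≡ (if b then f i else 0) + sumOver U (removeAt f i)
  sumOver-insertAt U             f zero    inside  = refl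
  sumOver-insertAt U             f zero    outside = refl
  sumOver-insertAt (outside ∷ U) f (suc i) b       = sumOver-insertAt U (f ∘ suc) i b
  sumOver-insertAt (inside  ∷ U) f (suc i) b       =
    trans (cong (f zero +_) (sumOver-insertAt U (f ∘ suc) i b))
    (x∙yz≈y∙xz (f zero) (if b then f (suc i) else 0) (sumOver U (removeAt (f ∘ suc) i)))

  sum-sumOver-comm : ∀ {m n} (W : Subset n) (g : Fin m → Fin n → ℕ) →
    sum (λ k → sumOver W (g k)) ≡ sumOver W (λ l → sum (λ k → g k l))
  sum-sumOver-comm {m} []            g = sum-replicate-zero m
  sum-sumOver-comm     (outside ∷ W) g = sum-sumOver-comm W (λ k → g k ∘ suc)
  sum-sumOver-comm     (inside  ∷ W) g = trans (∑-distrib-+ (λ k → g k zero) _)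
    (cong (sum (λ k → g k zero) +_) (sum-sumOver-comm W (λ k → g k ∘ suc)))

  ∣∣+∣∁∣ : ∀ {n} (U : Subset n) → ∣ U ∣ + ∣ ∁ U ∣ ≡ n
  ∣∣+∣∁∣ U = trans (cong (∣ U ∣ +_) (∣∁p∣≡n∸∣p∣ U)) (m+[n∸m]≡n (∣p∣≤n U))

  argmin-exists : ∀ {n} (f : Fin (suc n) → ℕ) → ∃ λ i → ∀ j → f i ≤ f j
  argmin-exists f = ExtremaNat.argmin f zero (allFin _) ,
    λ j → All.lookup (ExtremaNat.f[argmin]≤f[xs] {f = f} zero (allFin _)) (∈-allFin j)

-- Greedy partitions of small discrepancy.

module Splitting where
  open import Data.Nat.Base
  open import Data.Nat.Properties
  open import Algebra.Properties.CommutativeSemigroup +-commutativeSemigroup using (xy∙z≈y∙xz)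
  open import Data.Nat.Tactic.RingSolver using (solve-∀)
  open import Algebra.Properties.CommutativeMonoid.Sum +-0-commutativeMonoid using (sum; sum-remove)
  open Sums

  data Gap {n} (M : ℕ) (d : Fin n → ℕ) (s : ℕ) : Set where
    below-all : s ≤ M → (∀ i → s ≤ d i) → Gap M d s
    -- j terms are at least x; the other k, of sum T, were subtracted from a gap of at most x.
    leftover  : ∀ j k x T → j + k ≡ n → k ≤ T → 1 ≤ T → s + T ≤ x → x ≤ M →
                j * x + T ≤ sum d → Gap M d s

  -- `U` is the heavier side, so the discrepancy s is a natural number in an equation without
  -- subtraction. M is separate from n because the induction lowers n while the bound on the terms
  -- stays fixed.
  Split : ∀ {n} → ℕ → (Fin n → ℕ) → Set
  Split {n} M d = ∃ λ (U : Subset n) → ∃ λ s → sumOver U d ≡ sumOver (∁ U) d + s × Gap M d s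

  -- Removing a least term first makes the induction add the terms in decreasing order.
  split : ∀ {n} M (d : Fin n → ℕ) → (∀ i → 1 ≤ d i) → (∀ i → d i ≤ M) → Split M d
  split {zero}  M d 1≤d d≤M = [] , 0 , refl , below-all z≤n λ ()
  split {suc n} M d 1≤d d≤M with argmin-exists d
  ... | i , dᵢ≤d with split M (removeAt d i) (1≤d ∘ punchIn i) (d≤M ∘ punchIn i)
  ...   | U , s , U≡ , gap with s ≤? d i
  -- Index `i` goes to the lighter side `∁ U`, which then weighs at least as much as `U`: the sides
  -- swap roles, and the new gap is at most the least term `d i`.
  ...     | yes s≤dᵢ =
    insertAt (∁ U) i inside , d i ∸ s , eq ,
    below-all (≤-trans (m∸n≤m (d i) s) (d≤M i)) (λ j → ≤-trans (m∸n≤m (d i) s) (dᵢ≤d j))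
    where
    open ≤-Reasoning
    d′ = removeAt d i
    eq : sumOver (insertAt (∁ U) i inside) d ≡ sumOver (∁ (insertAt (∁ U) i inside)) d + (d i ∸ s)
    eq = begin-equality
      sumOver (insertAt (∁ U) i inside) d               ≡⟨ sumOver-insertAt (∁ U) d i inside ⟩
      d i + sumOver (∁ U) d′                            ≡⟨ +-comm (d i) _ ⟩
      sumOver (∁ U) d′ + d i                            ≡⟨ cong (sumOver (∁ U) d′ +_) (m+[n∸m]≡n s≤dᵢ) ⟨
      sumOver (∁ U) d′ + (s + (d i ∸ s))                ≡⟨ +-assoc (sumOver (∁ U) d′) s _ ⟨
      sumOver (∁ U) d′ + s + (d i ∸ s)                  ≡⟨ cong (_+ (d i ∸ s)) U≡ ⟨
      sumOver U d′ + (d i ∸ s)                          ≡⟨ cong (λ V → sumOver V d′ + (d i ∸ s)) (¬-involutive (∪-∩-booleanAlgebra n) U) ⟨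
      sumOver (∁ (∁ U)) d′ + (d i ∸ s)                  ≡⟨ cong (_+ (d i ∸ s)) (sumOver-insertAt (∁ (∁ U)) d i outside) ⟨
      sumOver (insertAt (∁ (∁ U)) i outside) d + (d i ∸ s)
        ≡⟨ cong (λ V → sumOver V d + (d i ∸ s)) (map-insertAt _ inside (∁ U) i) ⟨
      sumOver (∁ (insertAt (∁ U) i inside)) d + (d i ∸ s) ∎
  -- Here `U` remains the heavier side after `i` has joined `∁ U`.
  ...     | no s≰dᵢ =
    insertAt U i outside , s ∸ d i , eq , gap′ gap
    where
    open ≤-Reasoning
    d′ = removeAt d i
    dᵢ≤s = ≰⇒≥ s≰dᵢ
    eq : sumOver (insertAt U i outside) d ≡ sumOver (∁ (insertAt U i outside)) d + (s ∸ d i)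
    eq = begin-equality
      sumOver (insertAt U i outside) d            ≡⟨ sumOver-insertAt U d i outside ⟩
      sumOver U d′                                ≡⟨ U≡ ⟩
      sumOver (∁ U) d′ + s                        ≡⟨ cong (sumOver (∁ U) d′ +_) (m+[n∸m]≡n dᵢ≤s) ⟨
      sumOver (∁ U) d′ + (d i + (s ∸ d i))        ≡⟨ xy∙z≈y∙xz (d i) (sumOver (∁ U) d′) (s ∸ d i) ⟨
      d i + sumOver (∁ U) d′ + (s ∸ d i)          ≡⟨ cong (_+ (s ∸ d i)) (sumOver-insertAt (∁ U) d i inside) ⟨
      sumOver (insertAt (∁ U) i inside) d + (s ∸ d i)
        ≡⟨ cong (λ V → sumOver V d + (s ∸ d i)) (map-insertAt _ outside U i) ⟨
      sumOver (∁ (insertAt U i outside)) d + (s ∸ d i) ∎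
    gap′ : Gap M d′ s → Gap M d (s ∸ d i)
    -- The subtractions begin: x is the gap s just before them, the other n terms are all at least
    -- x, and T consists of `d i` alone.
    gap′ (below-all s≤M s≤d′) =
      leftover n 1 s (d i) (+-comm n 1) (1≤d i) (1≤d i) (≤-reflexive (m∸n+n≡m dᵢ≤s)) s≤M (begin
        n * s + d i   ≤⟨ +-monoˡ-≤ (d i) (*≤sum s≤d′) ⟩
        sum d′ + d i  ≡⟨ +-comm _ (d i) ⟩
        d i + sum d′  ≡⟨ sum-remove d ⟨
        sum d         ∎)
    -- The subtractions continue with x and j fixed: `d i` joins T and, being at least 1, preserves
    -- k ≤ T.
    gap′ (leftover j k x T j+k≡n k≤T 1≤T s+T≤x x≤M jx+T≤) =
      leftover j (suc k) x (d i + T) (trans (+-suc j k) (cong suc j+k≡n))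
        (+-mono-≤ (1≤d i) k≤T) (≤-trans 1≤T (m≤n+m T (d i)))
        (begin
          s ∸ d i + (d i + T) ≡⟨ +-assoc (s ∸ d i) (d i) T ⟨
          s ∸ d i + d i + T   ≡⟨ cong (_+ T) (m∸n+n≡m dᵢ≤s) ⟩
          s + T               ≤⟨ s+T≤x ⟩
          x                   ∎)
        x≤M
        (begin
          j * x + (d i + T) ≡⟨ +-assoc (j * x) (d i) T ⟨
          j * x + d i + T   ≡⟨ xy∙z≈y∙xz (j * x) (d i) T ⟩
          d i + (j * x + T) ≤⟨ +-monoʳ-≤ (d i) jx+T≤ ⟩
          d i + sum d′      ≡⟨ sum-remove d ⟨
          sum d             ∎)

  -- With M = n, the estimates k ≤ T and x ≤ n give k * x ≤ n * T, so n * s ≤ j * x is left after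
  -- cancelling n * T; T ≥ 1 makes the bound strict. The first alternative stays pointwise for the
  -- sake of the equality case.
  gap-bound : ∀ {n s} {d : Fin n → ℕ} → Gap n d s → (∀ i → s ≤ d i) ⊎ n * s < sum d
  gap-bound (below-all _ s≤d) = inj₁ s≤d
  gap-bound {n} {s} {d} (leftover j k x T j+k≡n k≤T 1≤T s+T≤x x≤n jx+T≤) =
    inj₂ (≤-<-trans (+-cancelʳ-≤ (n * T) (n * s) (j * x) (begin
      n * s + n * T ≡⟨ *-distribˡ-+ n s T ⟨
      n * (s + T)   ≤⟨ *-monoʳ-≤ n s+T≤x ⟩
      n * x         ≡⟨ cong (_* x) j+k≡n ⟨
      (j + k) * x   ≡⟨ *-distribʳ-+ x j k ⟩
      j * x + k * x ≤⟨ +-monoʳ-≤ (j * x) (*-mono-≤ k≤T x≤n) ⟩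
      j * x + T * n ≡⟨ cong (j * x +_) (*-comm T n) ⟩
      j * x + n * T ∎)) (≤-trans (m<m+n (j * x) 1≤T) jx+T≤))
    where open ≤-Reasoning

  -- With v the lighter volume and s the discrepancy, v = 0 would make s the whole volume, and two
  -- copies of a positive s do not fit into s. This makes both sides of the partition nonempty.
  lighter-side>0 : ∀ n v s → 0 < v + s + v → (2 + n) * s ≤ v + s + v → 0 < v
  lighter-side>0 n (suc v) s       _   _  = z<s
  lighter-side>0 n zero    zero    0<0 _  = 0<0
  lighter-side>0 n zero    (suc s) _   ≤s =
    contradiction (≤-trans ≤s (≤-reflexive (+-identityʳ (suc s)))) (<⇒≱ (m<m+n (suc s) z<s))

  -- Both sides are N times the total volume v + s + v, where N = 2 + n. Thus N * s ≤ total amounts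
  -- to (N - 1) * total ≤ 2 * v * N.
  split-identity : ∀ n v s → 2 * v * (2 + n) + (2 + n) * s ≡ (1 + n) * (v + s + v) + (v + s + v)
  split-identity = solve-∀

-- Volumes and edge counts in a connected graph.

module Volumes {n} (G : Graph (2 ℕ.+ n)) (connected : Connected G) where
  open import Data.Nat.Base
  open import Data.Nat.DivMod using (m≡m%n+[m/n]*n; [m+kn]%n≡m%n)
  open import Data.Nat.Properties
  open import Data.Nat.Tactic.RingSolver using (solve-∀)
  open import Algebra.Properties.CommutativeMonoid.Sum +-0-commutativeMonoid using (sum)
  open Graph G using (_∼_; _∼?_) renaming (sym to ∼-sym)
  open Sums
  open Splitting

  N : ℕ
  N = 2 + n

  total : ℕ
  total = sum (degree G)

  minVol : Subset N → ℕ
  minVol U = vol G U ⊓ vol G (∁ U)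

  weight≤1 : ∀ i j → weight G i j ≤ 1
  weight≤1 i j with i ∼? j
  ... | yes _ = ≤-refl
  ... | no  _ = z≤n

  weight-sym-≤ : ∀ i j → weight G i j ≤ weight G j i
  weight-sym-≤ i j with i ∼? j | j ∼? i
  ... | yes _   | yes _   = ≤-refl
  ... | yes i∼j | no  j≁i = contradiction (∼-sym i∼j) j≁i
  ... | no  _   | _       = z≤n

  weight-∼ : ∀ {i j} → i ∼ j → weight G i j ≡ 1
  weight-∼ {i} {j} i∼j = cong (if_then 1 else 0) (dec-true (i ∼? j) i∼j)

  degree≤N : ∀ i → degree G i ≤ N
  degree≤N i = ≤-trans (sum≤* (weight≤1 i)) (≤-reflexive (*-identityʳ N))

  first-step : ∀ {i j} → i ≢ j → Star _∼_ i j → ∃ (i ∼_)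
  first-step i≢j ε         = contradiction refl i≢j
  first-step i≢j (i∼k ◅ _) = _ , i∼k

  -- A walk to the other vertex `punchIn i zero` has a first edge, which counts towards the degree
  -- even if it is a loop.
  1≤degree : ∀ i → 1 ≤ degree G i
  1≤degree i with k , i∼k ← first-step (punchInᵢ≢i i zero ∘ sym) (connected i (punchIn i zero)) =
    ≤-trans (≤-reflexive (sym (weight-∼ i∼k))) (term≤sum (weight G i) k)

  vol-∁ : ∀ U → vol G U + vol G (∁ U) ≡ total
  vol-∁ U = sumOver-∁ U (degree G)

  0<vol : ∀ {U} → Nonempty U → 0 < vol G U
  0<vol (i , i∈U) = ≤-trans (1≤degree i) (term≤sumOver (degree G) i∈U)

  0<minVol : ∀ {U} → Proper U → 0 < minVol U
  0<minVol (U≠∅ , ∁U≠∅) = ⊓-pres-m< (0<vol U≠∅) (0<vol ∁U≠∅)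

  0<total : 0 < total
  0<total = ≤-trans (1≤degree zero) (term≤sum (degree G) zero)

  -- The first step of the walk that leaves `U` is such an edge.
  crossing-edge : ∀ {U i j} → i ∈ U → j ∈ ∁ U → Star _∼_ i j →
                  ∃ λ k → ∃ λ l → k ∈ U × l ∈ ∁ U × k ∼ l
  crossing-edge i∈U j∈∁U ε = contradiction i∈U (x∈∁p⇒x∉p j∈∁U)
  crossing-edge {U} i∈U j∈∁U (_◅_ {j = k} i∼k k⋆j) with k ∈? U
  ... | yes k∈U = crossing-edge k∈U j∈∁U k⋆j
  ... | no  k∉U = _ , k , i∈U , x∉p⇒x∈∁p k∉U , i∼k

  -- This makes h positive, so that it can be cancelled in the equality case.
  0<edges : ∀ {U} → Proper U → 0 < edges G U (∁ U)
  0<edges {U} ((i , i∈U) , (j , j∈∁U))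
    with k , l , k∈U , l∈∁U , k∼l ← crossing-edge i∈U j∈∁U (connected i j) = begin
      1                           ≡⟨ weight-∼ k∼l ⟨
      weight G k l                ≤⟨ term≤sumOver (weight G k) l∈∁U ⟩
      sumOver (∁ U) (weight G k)  ≤⟨ term≤sumOver (λ k → sumOver (∁ U) (weight G k)) k∈U ⟩
      edges G U (∁ U)             ∎
    where open ≤-Reasoning

  edges≤volˡ : ∀ U W → edges G U W ≤ vol G U
  edges≤volˡ U W = sumOver-mono U (λ k → sumOver≤sum W (weight G k))

  -- Exchanging the summations and using the symmetry of the weights turns column sums into degrees.
  edges≤volʳ : ∀ U W → edges G U W ≤ vol G W
  edges≤volʳ U W = begin
    edges G U W                                ≤⟨ sumOver≤sum U (λ k → sumOver W (weight G k)) ⟩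
    sum (λ k → sumOver W (weight G k))         ≡⟨ sum-sumOver-comm W (weight G) ⟩
    sumOver W (λ l → sum (λ k → weight G k l)) ≤⟨ sumOver-mono W (λ l → sum-mono (λ k → weight-sym-≤ k l)) ⟩
    vol G W                                    ∎
    where open ≤-Reasoning

  2*edges≤vol+vol : ∀ U W → 2 * edges G U W ≤ vol G U + vol G W
  2*edges≤vol+vol U W = +-mono-≤ (edges≤volˡ U W)
    (≤-trans (≤-reflexive (+-identityʳ (edges G U W))) (edges≤volʳ U W))

  -- Both volumes are multiples of the common degree s, which is positive; dividing by s shows that
  -- `U` has exactly one vertex more than `∁ U`.
  constant-split⇒odd : ∀ (U : Subset N) {s} → (∀ i → degree G i ≡ s) →
                       vol G U ≡ vol G (∁ U) + s → N % 2 ≡ 1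
  constant-split⇒odd U {zero}  d≡s _  = contradiction (≤-trans (1≤degree zero) (≤-reflexive (d≡s zero))) λ ()
  constant-split⇒odd U {s@(suc _)} d≡s U≡ = trans (cong (_% 2) N≡1+2k) ([m+kn]%n≡m%n 1 ∣ ∁ U ∣ 2)
    where
    open ≤-Reasoning
    ∣U∣≡1+∣∁U∣ : ∣ U ∣ ≡ suc ∣ ∁ U ∣
    ∣U∣≡1+∣∁U∣ = *-cancelʳ-≡ ∣ U ∣ (suc ∣ ∁ U ∣) s (begin-equality
      ∣ U ∣ * s         ≡⟨ sumOver-constant U d≡s ⟨
      vol G U           ≡⟨ U≡ ⟩
      vol G (∁ U) + s   ≡⟨ cong (_+ s) (sumOver-constant (∁ U) d≡s) ⟩
      ∣ ∁ U ∣ * s + s   ≡⟨ +-comm (∣ ∁ U ∣ * s) s ⟩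
      suc ∣ ∁ U ∣ * s   ∎)
    1+k+k≡1+k*2 : ∀ k → suc k + k ≡ 1 + k * 2
    1+k+k≡1+k*2 = solve-∀
    N≡1+2k : N ≡ 1 + ∣ ∁ U ∣ * 2
    N≡1+2k = begin-equality
      N                      ≡⟨ ∣∣+∣∁∣ U ⟨
      ∣ U ∣ + ∣ ∁ U ∣        ≡⟨ cong (_+ ∣ ∁ U ∣) ∣U∣≡1+∣∁U∣ ⟩
      suc ∣ ∁ U ∣ + ∣ ∁ U ∣  ≡⟨ 1+k+k≡1+k*2 ∣ ∁ U ∣ ⟩
      1 + ∣ ∁ U ∣ * 2        ∎

  -- The inequality is (N - 1)/N ≤ 2μ/total with denominators cleared, for μ the lighter volume; the
  -- last component settles the case of equality.
  split⇒balanced-cut : Split N (degree G) → ∃ λ U → Proper U × (N ∸ 1) * total ≤ 2 * minVol U * N ×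
    (2 * minVol U * N ≤ (N ∸ 1) * total → Regular G × N % 2 ≡ 1)
  split⇒balanced-cut (U , s , U≡ , gap) =
    U , (sumOver>0⇒nonempty U (degree G) (≤-trans 0<v v≤) , sumOver>0⇒nonempty (∁ U) (degree G) 0<v) ,
    -- Adding N * s to both sides reduces the claim to N * s ≤ total; the reverse inequality reduces
    -- likewise to total ≤ N * s.
    +-cancelʳ-≤ (N * s) _ _ (begin
      (N ∸ 1) * total + N * s     ≤⟨ +-monoʳ-≤ ((N ∸ 1) * total) N*s≤total ⟩
      (N ∸ 1) * total + total     ≡⟨ balance-identity ⟨
      2 * minVol U * N + N * s    ∎) ,
    λ tight → equality-case (gap-bound gap) (+-cancelˡ-≤ ((N ∸ 1) * total) _ _ (begin
      (N ∸ 1) * total + total     ≡⟨ balance-identity ⟨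
      2 * minVol U * N + N * s    ≤⟨ +-monoˡ-≤ (N * s) tight ⟩
      (N ∸ 1) * total + N * s     ∎))
    where
    open ≤-Reasoning
    v = vol G (∁ U)

    v≤ : v ≤ vol G U
    v≤ = ≤-trans (m≤m+n v s) (≤-reflexive (sym U≡))

    total≡ : total ≡ v + s + v
    total≡ = trans (sym (vol-∁ U)) (cong (_+ v) U≡)

    N*s≤total : N * s ≤ total
    N*s≤total = [ *≤sum , <⇒≤ ]′ (gap-bound gap)

    0<v : 0 < v
    0<v = lighter-side>0 n v s (subst (0 <_) total≡ 0<total) (subst (N * s ≤_) total≡ N*s≤total)

    minVol≡v : minVol U ≡ v
    minVol≡v = m≥n⇒m⊓n≡n v≤

    balance-identity : 2 * minVol U * N + N * s ≡ (N ∸ 1) * total + total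
    balance-identity = begin-equality
      2 * minVol U * N + N * s              ≡⟨ cong (λ m → 2 * m * N + N * s) minVol≡v ⟩
      2 * v * N + N * s                     ≡⟨ split-identity n v s ⟩
      (1 + n) * (v + s + v) + (v + s + v)   ≡⟨ cong (λ t → (1 + n) * t + t) total≡ ⟨
      (N ∸ 1) * total + total               ∎

    equality-case : (∀ i → s ≤ degree G i) ⊎ N * s < total → total ≤ N * s → Regular G × N % 2 ≡ 1
    equality-case (inj₂ N*s<total) total≤N*s = contradiction total≤N*s (<⇒≱ N*s<total)
    equality-case (inj₁ s≤d)       total≤N*s = (λ i j → trans (d≡s i) (sym (d≡s j))) , constant-split⇒odd U d≡s U≡
      where
      d≡s = sum-tight (degree G) s≤d total≤N*s

  -- M can be taken to be N because a vertex has at most one edge to each of the N vertices, itself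
  -- included.
  balanced-cut : ∃ λ U → Proper U × (N ∸ 1) * total ≤ 2 * minVol U * N ×
    (2 * minVol U * N ≤ (N ∸ 1) * total → Regular G × N % 2 ≡ 1)
  balanced-cut = split⇒balanced-cut (split N (degree G) 1≤degree degree≤N)

  -- Volumes are proportional to cardinalities here, and for odd N the smaller of two complementary
  -- sets has at most (N - 1)/2 elements.
  odd⇒minVol≤ : Regular G → N % 2 ≡ 1 → ∀ U → 2 * minVol U * N ≤ (N ∸ 1) * total
  odd⇒minVol≤ regular odd U = begin
    2 * minVol U * N     ≡⟨ cong (λ m → 2 * m * N) minVol≡ ⟩
    2 * (e * s) * N      ≡⟨ rearrange e s N ⟩
    2 * e * (N * s)      ≤⟨ *-mono-≤ 2*e≤N∸1 (*≤sum (λ i → ≤-reflexive (regular zero i))) ⟩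
    (N ∸ 1) * total      ∎
    where
    open ≤-Reasoning
    s = degree G zero
    e = ∣ U ∣ ⊓ ∣ ∁ U ∣
    q = N / 2

    rearrange : ∀ e s N → 2 * (e * s) * N ≡ 2 * e * (N * s)
    rearrange = solve-∀

    N≡1+q*2 : N ≡ suc (q * 2)
    N≡1+q*2 = trans (m≡m%n+[m/n]*n N 2) (cong (_+ q * 2) odd)

    -- As N = 2q + 1, this strict bound yields e ≤ q.
    e*2<[1+q]*2 : e * 2 < suc q * 2
    e*2<[1+q]*2 = begin-strict
      e * 2           ≡⟨ *-comm e 2 ⟩
      e + (e + 0)     ≤⟨ +-mono-≤ (m⊓n≤m ∣ U ∣ ∣ ∁ U ∣) (≤-trans (≤-reflexive (+-identityʳ e)) (m⊓n≤n ∣ U ∣ ∣ ∁ U ∣)) ⟩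
      ∣ U ∣ + ∣ ∁ U ∣ ≡⟨ ∣∣+∣∁∣ U ⟩
      N               ≡⟨ N≡1+q*2 ⟩
      suc (q * 2)     <⟨ ≤-refl ⟩
      suc q * 2       ∎

    2*e≤N∸1 : 2 * e ≤ N ∸ 1
    2*e≤N∸1 = begin
      2 * e    ≡⟨ *-comm 2 e ⟩
      e * 2    ≤⟨ *-monoˡ-≤ 2 (s≤s⁻¹ (*-cancelʳ-< 2 e (suc q) e*2<[1+q]*2)) ⟩
      q * 2    ≡⟨ cong (_∸ 1) N≡1+q*2 ⟨
      N ∸ 1    ∎

    minVol≡ : minVol U ≡ e * s
    minVol≡ = trans
      (cong₂ _⊓_ (sumOver-constant U (λ i → regular i zero)) (sumOver-constant (∁ U) (λ i → regular i zero)))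
      (sym (*-distribʳ-⊓ s ∣ U ∣ ∣ ∁ U ∣))

open import Data.Integer.Base using (+_; +≤+)
open import Data.Rational.Base
  using (ℚ; 0ℚ; 1ℚ; mkℚ; _+_; _*_; _/_; 1/_; _≤_; *≤*; Positive; NonNegative; ≢-nonZero)
open import Data.Rational.Properties hiding (_≤?_)

open Extrema (DecTotalOrder.totalOrder ≤-decTotalOrder)
  using (min; max; argmin-sel; argmax-sel; min≤⊤; min≤xs; ⊥≤max; xs≤max)

-- Extrema of finite lists of rationals.

minimum-∈ : ∀ {x} xs → x List.∈ xs → minimum xs List.∈ xs
minimum-∈ (x ∷ xs) _ with argmin-sel (λ y → y) x xs
... | inj₁ min≡x  = here min≡x
... | inj₂ min∈xs = there min∈xs

minimum-≤ : ∀ {x} xs → x List.∈ xs → minimum xs ≤ x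
minimum-≤ (x ∷ xs) (here refl)  = min≤⊤ x xs
minimum-≤ (x ∷ xs) (there x∈xs) = All.lookup (min≤xs x xs) x∈xs

maximum-∈ : ∀ {x} xs → x List.∈ xs → maximum xs List.∈ xs
maximum-∈ (x ∷ xs) _ with argmax-sel (λ y → y) x xs
... | inj₁ max≡x  = here max≡x
... | inj₂ max∈xs = there max∈xs

≤-maximum : ∀ {x} xs → x List.∈ xs → x ≤ maximum xs
≤-maximum (x ∷ xs) (here refl)  = ⊥≤max x xs
≤-maximum (x ∷ xs) (there x∈xs) = All.lookup (xs≤max x xs) x∈xs

-- The element `x` makes the list of values nonempty, so its extrema are attained instead of being
-- the default value.
module _ {A : Set} {P : A → Set} (P? : ∀ x → Dec (P x)) (f : A → ℚ) (xs : List A)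
         {x : A} (x∈xs : x List.∈ xs) (px : P x) where

  private
    values : List ℚ
    values = map f (filter P? xs)

    f[x]∈ : f x List.∈ values
    f[x]∈ = ∈-map⁺ f (∈-filter⁺ P? x∈xs px)

    attained : ∀ {v} → v List.∈ values → ∃ λ y → P y × v ≡ f y
    attained v∈ =
      let y , y∈ , v≡ = ∈-map⁻ f v∈
      in y , proj₂ (∈-filter⁻ P? {xs = xs} y∈) , v≡

  minimum-filter-≤ : minimum values ≤ f x
  minimum-filter-≤ = minimum-≤ values f[x]∈

  minimum-filter-attained : ∃ λ y → P y × minimum values ≡ f y
  minimum-filter-attained = attained (minimum-∈ values f[x]∈)

  ≤-maximum-filter : f x ≤ maximum values
  ≤-maximum-filter = ≤-maximum values f[x]∈

  maximum-filter-attained : ∃ λ y → P y × maximum values ≡ f y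
  maximum-filter-attained = attained (maximum-∈ values f[x]∈)

-- Natural numbers and their quotients among the rationals.

fromℕ≡mkℚ : ∀ a → fromℕ a ≡ mkℚ (+ a) 0 (Coprimality.sym (Coprimality.1-coprimeTo a))
fromℕ≡mkℚ a = normalize-coprime (Coprimality.sym (Coprimality.1-coprimeTo a))

fromℕ-+ : ∀ a b → fromℕ (a ℕ.+ b) ≡ fromℕ a + fromℕ b
-- For a variable a the fraction `+ a / 1` is stuck on its normalisation; rewriting it as a literal
-- `mkℚ` lets the rational operations compute.
fromℕ-+ a b = sym (trans (cong₂ _+_ (fromℕ≡mkℚ a) (fromℕ≡mkℚ b))
  (cong (_/ 1) (cong₂ ℤ._+_ (ℤ.*-identityʳ (+ a)) (ℤ.*-identityʳ (+ b)))))

fromℕ-* : ∀ a b → fromℕ (a ℕ.* b) ≡ fromℕ a * fromℕ b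
fromℕ-* a b = sym (trans (cong₂ _*_ (fromℕ≡mkℚ a) (fromℕ≡mkℚ b))
  (cong (_/ 1) (sym (ℤ.pos-* a b))))

fromℕ-mono-≤ : ∀ {a b} → a ℕ.≤ b → fromℕ a ≤ fromℕ b
fromℕ-mono-≤ {a} {b} a≤b = subst₂ _≤_ (sym (fromℕ≡mkℚ a)) (sym (fromℕ≡mkℚ b))
  (*≤* (ℤ.*-monoʳ-≤-nonNeg (+ 1) (+≤+ a≤b)))

fromℕ-cancel-≤ : ∀ {a b} → fromℕ a ≤ fromℕ b → a ℕ.≤ b
fromℕ-cancel-≤ {a} {b} a≤b = ℤ.drop‿+≤+ (ℤ.*-cancelʳ-≤-pos (+ a) (+ b) (+ 1)
  (drop-*≤* (subst₂ _≤_ (fromℕ≡mkℚ a) (fromℕ≡mkℚ b) a≤b)))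

fromℕ-pos : ∀ b .{{_ : ℕ.NonZero b}} → Positive (fromℕ b)
fromℕ-pos b = normalize-pos b 1

pos⇒≢0 : ∀ q .{{_ : Positive q}} → q ≢ 0ℚ
pos⇒≢0 q q≡0 = <-irrefl (sym q≡0) (positive⁻¹ q)

⊘-*-cancel : ∀ p q .{{_ : Positive q}} → (p ⊘ q) * q ≡ p
⊘-*-cancel p q with q ≟ 0ℚ
... | yes q≡0 = contradiction q≡0 (pos⇒≢0 q)
... | no  q≢0 = begin
  p * 1/q * q   ≡⟨ *-assoc p 1/q q ⟩
  p * (1/q * q) ≡⟨ cong (p *_) (*-inverseˡ q {{≢-nonZero q≢0}}) ⟩
  p * 1ℚ        ≡⟨ *-identityʳ p ⟩
  p             ∎
  where
  open ≡-Reasoning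
  1/q = (1/ q) {{≢-nonZero q≢0}}

*-cancelʳ-≡-pos : ∀ {p q} r .{{_ : Positive r}} → p * r ≡ q * r → p ≡ q
*-cancelʳ-≡-pos r pr≡qr =
  ≤-antisym (*-cancelʳ-≤-pos r (≤-reflexive pr≡qr)) (*-cancelʳ-≤-pos r (≤-reflexive (sym pr≡qr)))

⊘-unique : ∀ x p q .{{_ : Positive q}} → x * q ≡ p → x ≡ p ⊘ q
⊘-unique x p q xq≡p = *-cancelʳ-≡-pos q (trans xq≡p (sym (⊘-*-cancel p q)))

⊘-pos : ∀ p q .{{_ : Positive p}} .{{_ : Positive q}} → Positive (p ⊘ q)
⊘-pos p q with q ≟ 0ℚ
... | yes q≡0 = contradiction q≡0 (pos⇒≢0 q)
... | no  q≢0 = pos*pos⇒pos p ((1/ q) {{≢-nonZero q≢0}}) {{1/pos⇒pos q}}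

infixl 8 _÷ℕ_
-- `cheegerRatio`, `dualCheegerRatio` and `balanceRatio` have this form by definition, so the lemmas
-- below apply to them directly.
_÷ℕ_ : ℕ → ℕ → ℚ
a ÷ℕ b = fromℕ a ⊘ fromℕ b

÷ℕ-pos : ∀ a b .{{_ : ℕ.NonZero a}} .{{_ : ℕ.NonZero b}} → Positive (a ÷ℕ b)
÷ℕ-pos a b = ⊘-pos (fromℕ a) (fromℕ b) {{fromℕ-pos a}} {{fromℕ-pos b}}

÷ℕ-cancel : ∀ a b .{{_ : ℕ.NonZero b}} → a ÷ℕ b * fromℕ b ≡ fromℕ a
÷ℕ-cancel a b = ⊘-*-cancel (fromℕ a) (fromℕ b) {{fromℕ-pos b}}

÷ℕ-cancel-* : ∀ a b d .{{_ : ℕ.NonZero b}} → a ÷ℕ b * fromℕ (b ℕ.* d) ≡ fromℕ (a ℕ.* d)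
÷ℕ-cancel-* a b d = begin
  a ÷ℕ b * fromℕ (b ℕ.* d)       ≡⟨ cong (a ÷ℕ b *_) (fromℕ-* b d) ⟩
  a ÷ℕ b * (fromℕ b * fromℕ d)   ≡⟨ *-assoc (a ÷ℕ b) (fromℕ b) (fromℕ d) ⟨
  a ÷ℕ b * fromℕ b * fromℕ d     ≡⟨ cong (_* fromℕ d) (÷ℕ-cancel a b) ⟩
  fromℕ a * fromℕ d              ≡⟨ fromℕ-* a d ⟨
  fromℕ (a ℕ.* d)                ∎
  where open ≡-Reasoning

÷ℕ-cross : ∀ c b d .{{_ : ℕ.NonZero d}} → c ÷ℕ d * fromℕ (b ℕ.* d) ≡ fromℕ (c ℕ.* b)
÷ℕ-cross c b d = trans (cong (λ e → c ÷ℕ d * fromℕ e) (ℕ.*-comm b d)) (÷ℕ-cancel-* c d b)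

÷ℕ-mono-≤ : ∀ a b c d .{{_ : ℕ.NonZero b}} .{{_ : ℕ.NonZero d}} →
            a ℕ.* d ℕ.≤ c ℕ.* b → a ÷ℕ b ≤ c ÷ℕ d
÷ℕ-mono-≤ a b c d ad≤cb = *-cancelʳ-≤-pos (fromℕ (b ℕ.* d)) {{fromℕ-pos (b ℕ.* d) {{ℕ.m*n≢0 b d}}}}
  (subst₂ _≤_ (sym (÷ℕ-cancel-* a b d)) (sym (÷ℕ-cross c b d)) (fromℕ-mono-≤ ad≤cb))

÷ℕ-cancel-≤ : ∀ a b c d .{{_ : ℕ.NonZero b}} .{{_ : ℕ.NonZero d}} →
              a ÷ℕ b ≤ c ÷ℕ d → a ℕ.* d ℕ.≤ c ℕ.* b
÷ℕ-cancel-≤ a b c d a/b≤c/d = fromℕ-cancel-≤ (subst₂ _≤_ (÷ℕ-cancel-* a b d) (÷ℕ-cross c b d)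
  (*-monoʳ-≤-nonNeg (fromℕ (b ℕ.* d))
    {{pos⇒nonNeg (fromℕ (b ℕ.* d)) {{fromℕ-pos (b ℕ.* d) {{ℕ.m*n≢0 b d}}}}}} a/b≤c/d))

-- This serves to cancel the lighter volume μ in 2μ/total * E/μ, where E counts the edges across a
-- cut.
÷ℕ-compose : ∀ k a b c .{{_ : ℕ.NonZero b}} .{{_ : ℕ.NonZero c}} →
             (k ℕ.* b) ÷ℕ c * a ÷ℕ b ≡ (k ℕ.* a) ÷ℕ c
÷ℕ-compose k a b c = ⊘-unique _ (fromℕ (k ℕ.* a)) (fromℕ c) {{fromℕ-pos c}} (begin
  p * q * fromℕ c              ≡⟨ *-assoc p q (fromℕ c) ⟩
  p * (q * fromℕ c)            ≡⟨ cong (p *_) (*-comm q (fromℕ c)) ⟩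
  p * (fromℕ c * q)            ≡⟨ *-assoc p (fromℕ c) q ⟨
  p * fromℕ c * q              ≡⟨ cong (_* q) (÷ℕ-cancel (k ℕ.* b) c) ⟩
  fromℕ (k ℕ.* b) * q          ≡⟨ *-comm (fromℕ (k ℕ.* b)) q ⟩
  q * fromℕ (k ℕ.* b)          ≡⟨ cong (λ m → q * fromℕ m) (ℕ.*-comm k b) ⟩
  q * fromℕ (b ℕ.* k)          ≡⟨ ÷ℕ-cancel-* a b k ⟩
  fromℕ (a ℕ.* k)              ≡⟨ cong fromℕ (ℕ.*-comm a k) ⟩
  fromℕ (k ℕ.* a)              ∎)
  where
  open ≡-Reasoning
  p = (k ℕ.* b) ÷ℕ c
  q = a ÷ℕ b

-- This evaluates 2r/(1 + r) at r = a/b. For the lighter and heavier volumes of a partition, a + b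
-- is the total volume.
÷ℕ-harmonic : ∀ a b .{{_ : ℕ.NonZero a}} .{{_ : ℕ.NonZero b}} →
  (fromℕ 2 * a ÷ℕ b) ⊘ (1ℚ + a ÷ℕ b) ≡ (2 ℕ.* a) ÷ℕ (a ℕ.+ b)
÷ℕ-harmonic a b = sym (⊘-unique x (fromℕ 2 * r) (1ℚ + r)
    {{pos+pos⇒pos 1ℚ r {{÷ℕ-pos a b}}}} (*-cancelʳ-≡-pos (fromℕ b) {{fromℕ-pos b}} (begin
  x * (1ℚ + r) * fromℕ b             ≡⟨ *-assoc x (1ℚ + r) (fromℕ b) ⟩
  x * ((1ℚ + r) * fromℕ b)           ≡⟨ cong (x *_) (*-distribʳ-+ (fromℕ b) 1ℚ r) ⟩
  x * (1ℚ * fromℕ b + r * fromℕ b)   ≡⟨ cong (x *_) (cong₂ _+_ (*-identityˡ (fromℕ b)) (÷ℕ-cancel a b)) ⟩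
  x * (fromℕ b + fromℕ a)            ≡⟨ cong (x *_) (+-comm (fromℕ b) (fromℕ a)) ⟩
  x * (fromℕ a + fromℕ b)            ≡⟨ cong (x *_) (fromℕ-+ a b) ⟨
  x * fromℕ (a ℕ.+ b)                ≡⟨ ÷ℕ-cancel (2 ℕ.* a) (a ℕ.+ b) {{a+b≢0}} ⟩
  fromℕ (2 ℕ.* a)                    ≡⟨ fromℕ-* 2 a ⟩
  fromℕ 2 * fromℕ a                  ≡⟨ cong (fromℕ 2 *_) (÷ℕ-cancel a b) ⟨
  fromℕ 2 * (r * fromℕ b)            ≡⟨ *-assoc (fromℕ 2) r (fromℕ b) ⟨
  fromℕ 2 * r * fromℕ b              ∎)))
  where
  open ≡-Reasoning
  a+b≢0 = ℕ.>-nonZero (ℕ.≤-trans (ℕ.>-nonZero⁻¹ a) (ℕ.m≤m+n a b))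
  x = (2 ℕ.* a) ÷ℕ (a ℕ.+ b)
  r = a ÷ℕ b

-- The Cheeger, dual Cheeger and balance constants as extrema over cuts.

module Ratios {n} (G : Graph (2 ℕ.+ n)) (connected : Connected G) where
  open Volumes G connected

  instance
    total≢0 : ℕ.NonZero total
    total≢0 = ℕ.>-nonZero 0<total

  minVol≢0 : ∀ {U} → Proper U → ℕ.NonZero (minVol U)
  minVol≢0 pU = ℕ.>-nonZero (0<minVol pU)

  maxVol : Subset N → ℕ
  maxVol U = vol G U ℕ.⊔ vol G (∁ U)

  maxVol≢0 : ∀ {U} → Proper U → ℕ.NonZero (maxVol U)
  maxVol≢0 {U} pU = ℕ.>-nonZero (ℕ.≤-trans (0<minVol pU) (ℕ.m⊓n≤m⊔n (vol G U) (vol G (∁ U))))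

  minVol+maxVol : ∀ U → minVol U ℕ.+ maxVol U ≡ total
  minVol+maxVol U = trans (⊓+⊔ (vol G U) (vol G (∁ U))) (vol-∁ U)
    where
    ⊓+⊔ : ∀ x y → x ℕ.⊓ y ℕ.+ (x ℕ.⊔ y) ≡ x ℕ.+ y
    ⊓+⊔ x y with ℕ.≤-total x y
    ... | inj₁ x≤y = cong₂ ℕ._+_ (ℕ.m≤n⇒m⊓n≡m x≤y) (ℕ.m≤n⇒m⊔n≡n x≤y)
    ... | inj₂ y≤x = trans (cong₂ ℕ._+_ (ℕ.m≥n⇒m⊓n≡n y≤x) (ℕ.m≥n⇒m⊔n≡m y≤x)) (ℕ.+-comm y x)

  -- Any partition shows that the lists of ratios are nonempty; the balanced one is at hand.
  some-cut : ∃ λ U → Proper U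
  some-cut = let U , pU , _ = balanced-cut in U , pU

  cheeger-≤ : ∀ {U} → Proper U → cheeger G ≤ cheegerRatio G U
  cheeger-≤ {U} pU = minimum-filter-≤ proper? (cheegerRatio G) (subsets N) (∈-subsets U) pU

  cheeger-attained : ∃ λ U → Proper U × cheeger G ≡ cheegerRatio G U
  cheeger-attained = let U , pU = some-cut in
    minimum-filter-attained proper? (cheegerRatio G) (subsets N) (∈-subsets U) pU

  ≤-balance : ∀ {U} → Proper U → balanceRatio G U ≤ balance G
  ≤-balance {U} pU = ≤-maximum-filter proper? (balanceRatio G) (subsets N) (∈-subsets U) pU

  balance-attained : ∃ λ U → Proper U × balance G ≡ balanceRatio G U
  balance-attained = let U , pU = some-cut in
    maximum-filter-attained proper? (balanceRatio G) (subsets N) (∈-subsets U) pU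

  pairs : List (Subset N × Subset N)
  pairs = cartesianProduct (subsets N) (subsets N)

  ∈-pairs : ∀ U W → (U , W) List.∈ pairs
  ∈-pairs U W = ∈-cartesianProduct⁺ (∈-subsets U) (∈-subsets W)

  disjointNonempty-∁ : ∀ {U : Subset N} → Proper U → DisjointNonempty (U , ∁ U)
  disjointNonempty-∁ {U} (U≠∅ , ∁U≠∅) = U≠∅ , ∁U≠∅ ,
    λ (i , i∈) → let i∈U , i∈∁U = x∈p∩q⁻ U (∁ U) i∈ in x∈∁p⇒x∉p i∈∁U i∈U

  dualRatio≤dualCheeger : ∀ {U} → Proper U → dualCheegerRatio G U (∁ U) ≤ dualCheeger G
  dualRatio≤dualCheeger {U} pU = ≤-maximum-filter disjointNonempty? (uncurry (dualCheegerRatio G)) pairs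
    (∈-pairs U (∁ U)) (disjointNonempty-∁ pU)

  dualCheegerRatio≤1 : ∀ {V} W → Nonempty V → dualCheegerRatio G V W ≤ 1ℚ
  dualCheegerRatio≤1 {V} W V≠∅ =
    -- The bound `1ℚ` enters as `1 ÷ℕ 1`, which equals it by computation.
    ÷ℕ-mono-≤ (2 ℕ.* edges G V W) (vol G V ℕ.+ vol G W) 1 1
      {{ℕ.>-nonZero (ℕ.≤-trans (0<vol V≠∅) (ℕ.m≤m+n (vol G V) (vol G W)))}} (begin
        2 ℕ.* edges G V W ℕ.* 1          ≡⟨ ℕ.*-identityʳ (2 ℕ.* edges G V W) ⟩
        2 ℕ.* edges G V W                ≤⟨ 2*edges≤vol+vol V W ⟩
        vol G V ℕ.+ vol G W              ≡⟨ ℕ.*-identityˡ (vol G V ℕ.+ vol G W) ⟨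
        1 ℕ.* (vol G V ℕ.+ vol G W)      ∎)
    where open ℕ.≤-Reasoning

  dualCheeger≤1 : dualCheeger G ≤ 1ℚ
  dualCheeger≤1 =
    let U , pU = some-cut
        (V , W) , (V≠∅ , _) , h̄≡ = maximum-filter-attained disjointNonempty? (uncurry (dualCheegerRatio G)) pairs
          (∈-pairs U (∁ U)) (disjointNonempty-∁ pU)
    in ≤-trans (≤-reflexive h̄≡) (dualCheegerRatio≤1 W V≠∅)

-- The inequalities and the equality case, through a cut attaining the balance constant.

module MostBalancedCut {n} (G : Graph (2 ℕ.+ n)) (connected : Connected G)
  {U₀} (proper₀ : Proper U₀) (R≡ : balance G ≡ balanceRatio G U₀) where
  open Volumes G connected
  open Ratios G connected

  μ E₀ : ℕ
  μ = minVol U₀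
  E₀ = edges G U₀ (∁ U₀)

  instance
    μ≢0 : ℕ.NonZero μ
    μ≢0 = minVol≢0 proper₀

  balance-factor : ℚ
  balance-factor = (fromℕ 2 * balance G) ⊘ (1ℚ + balance G)

  balance-factor≡ : balance-factor ≡ (2 ℕ.* μ) ÷ℕ total
  balance-factor≡ = begin
    balance-factor                          ≡⟨ cong (λ r → (fromℕ 2 * r) ⊘ (1ℚ + r)) R≡ ⟩
    (fromℕ 2 * μ ÷ℕ maxVol U₀) ⊘ (1ℚ + μ ÷ℕ maxVol U₀)
                                            ≡⟨ ÷ℕ-harmonic μ (maxVol U₀) {{μ≢0}} {{maxVol≢0 proper₀}} ⟩
    (2 ℕ.* μ) ÷ℕ (μ ℕ.+ maxVol U₀)          ≡⟨ cong ((2 ℕ.* μ) ÷ℕ_) (minVol+maxVol U₀) ⟩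
    (2 ℕ.* μ) ÷ℕ total                      ∎
    where open ≡-Reasoning

  -- Lighter and heavier volume have the same sum for every partition, so the largest ratio comes
  -- with the largest lighter volume. Adding `minVol U` * μ to the cross-multiplied ratios replaces
  -- each heavier volume by the total.
  minVol≤μ : ∀ {U} → Proper U → minVol U ℕ.≤ μ
  minVol≤μ {U} pU = ℕ.*-cancelʳ-≤ (minVol U) μ total (begin
    minVol U ℕ.* total                              ≡⟨ cong (minVol U ℕ.*_) (minVol+maxVol U₀) ⟨
    minVol U ℕ.* (μ ℕ.+ maxVol U₀)                  ≡⟨ ℕ.*-distribˡ-+ (minVol U) μ (maxVol U₀) ⟩
    minVol U ℕ.* μ ℕ.+ minVol U ℕ.* maxVol U₀       ≤⟨ ℕ.+-mono-≤ (ℕ.≤-reflexive (ℕ.*-comm (minVol U) μ)) ratio≤ ⟩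
    μ ℕ.* minVol U ℕ.+ μ ℕ.* maxVol U               ≡⟨ ℕ.*-distribˡ-+ μ (minVol U) (maxVol U) ⟨
    μ ℕ.* (minVol U ℕ.+ maxVol U)                   ≡⟨ cong (μ ℕ.*_) (minVol+maxVol U) ⟩
    μ ℕ.* total                                     ∎)
    where
    open ℕ.≤-Reasoning
    ratio≤ : minVol U ℕ.* maxVol U₀ ℕ.≤ μ ℕ.* maxVol U
    ratio≤ = ÷ℕ-cancel-≤ (minVol U) (maxVol U) μ (maxVol U₀) {{maxVol≢0 pU}} {{maxVol≢0 proper₀}}
      (≤-trans (≤-balance pU) (≤-reflexive R≡))

  cheeger-pos : Positive (cheeger G)
  cheeger-pos = let U , pU , h≡ = cheeger-attained in subst Positive (sym h≡)
    (÷ℕ-pos (edges G U (∁ U)) (minVol U) {{ℕ.>-nonZero (0<edges pU)}} {{minVol≢0 pU}})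

  instance
    cheeger≥0 : NonNegative (cheeger G)
    cheeger≥0 = pos⇒nonNeg (cheeger G) {{cheeger-pos}}

  balance-≤ : (N ∸ 1) ÷ℕ N * cheeger G ≤ balance-factor * cheeger G
  balance-≤ = *-monoʳ-≤-nonNeg (cheeger G) (≤-trans
    (÷ℕ-mono-≤ (N ∸ 1) N (2 ℕ.* μ) total ≤2μ) (≤-reflexive (sym balance-factor≡)))
    where
    -- The greedy cut may differ from `U₀`, but its lighter volume is at most μ.
    ≤2μ : (N ∸ 1) ℕ.* total ℕ.≤ 2 ℕ.* μ ℕ.* N
    ≤2μ = let _ , pU , cut≤ , _ = balanced-cut in
      ℕ.≤-trans cut≤ (ℕ.*-monoˡ-≤ N (ℕ.*-monoʳ-≤ 2 (minVol≤μ pU)))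

  cheeger≤dual : balance-factor * cheeger G ≤ dualCheeger G
  cheeger≤dual = begin
    balance-factor * cheeger G               ≡⟨ cong (_* cheeger G) balance-factor≡ ⟩
    (2 ℕ.* μ) ÷ℕ total * cheeger G           ≤⟨ *-monoˡ-≤-nonNeg ((2 ℕ.* μ) ÷ℕ total) {{factor≥0}} (cheeger-≤ proper₀) ⟩
    (2 ℕ.* μ) ÷ℕ total * E₀ ÷ℕ μ             ≡⟨ ÷ℕ-compose 2 E₀ μ total ⟩
    (2 ℕ.* E₀) ÷ℕ total                      ≡⟨ cong ((2 ℕ.* E₀) ÷ℕ_) (vol-∁ U₀) ⟨
    dualCheegerRatio G U₀ (∁ U₀)             ≤⟨ dualRatio≤dualCheeger proper₀ ⟩
    dualCheeger G                            ∎
    where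
    open ≤-Reasoning
    factor≥0 : NonNegative ((2 ℕ.* μ) ÷ℕ total)
    factor≥0 = pos⇒nonNeg ((2 ℕ.* μ) ÷ℕ total) {{÷ℕ-pos (2 ℕ.* μ) total {{ℕ.m*n≢0 2 μ}}}}

  -- Cancelling h > 0 gives 2 * μ * N ≤ (N - 1) * total. The greedy cut has lighter volume at most
  -- μ, so its own inequality is tight as well.
  equality⇒ : (N ∸ 1) ÷ℕ N * cheeger G ≡ balance-factor * cheeger G → Regular G × N % 2 ≡ 1
  equality⇒ l≡m = let _ , pU , _ , tight⇒ = balanced-cut in
    tight⇒ (ℕ.≤-trans (ℕ.*-monoˡ-≤ N (ℕ.*-monoʳ-≤ 2 (minVol≤μ pU)))
      (÷ℕ-cancel-≤ (2 ℕ.* μ) total (N ∸ 1) N (≤-trans (≤-reflexive (sym balance-factor≡))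
        (*-cancelʳ-≤-pos (cheeger G) {{cheeger-pos}} (≤-reflexive (sym l≡m))))))

  -- Only the inequality opposite to `balance-≤` is left; regularity and odd N give it for every
  -- partition, in particular for `U₀`.
  equality⇐ : Regular G × N % 2 ≡ 1 → (N ∸ 1) ÷ℕ N * cheeger G ≡ balance-factor * cheeger G
  equality⇐ (regular , odd) = ≤-antisym balance-≤ (*-monoʳ-≤-nonNeg (cheeger G) (≤-trans
    (≤-reflexive balance-factor≡)
    (÷ℕ-mono-≤ (2 ℕ.* μ) total (N ∸ 1) N (odd⇒minVol≤ regular odd U₀))))

theorem4p1 : (N : ℕ) → 2 ≤ℕ N → (G : Graph N) → Connected G →
    let h  = cheeger G
        h̄  = dualCheeger G
        R  = balance G
        l  = (fromℕ (N ∸ 1) ⊘ fromℕ N) * h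
        m  = ((fromℕ 2 * R) ⊘ (1ℚ + R)) * h
    in (l ≤ m × m ≤ h̄ × h̄ ≤ 1ℚ) × (l ≡ m ⇔ (Regular G × N % 2 ≡ 1))
theorem4p1 (ℕ.suc (ℕ.suc n)) (ℕ.s≤s (ℕ.s≤s _)) G connected =
  (balance-≤ , cheeger≤dual , dualCheeger≤1) , mk⇔ equality⇒ equality⇐
  where
  open Ratios G connected
  open MostBalancedCut G connected (proj₁ (proj₂ balance-attained)) (proj₂ (proj₂ balance-attained))
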